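{- Let $n=mp$, where $m$ is a positive integer and $p$ is a prime with $\gcd(m,p)=1$. Let $s,t$ be positive integers with $st=p-1$, and let $g$ be a generator of $\mathbb{Z}_p^\times$. Let $e$ be an integer satisfying $$e\equiv 1\pmod m,\qquad e\equiv g^t\pmod p,$$ and let $G=\langle e\rangle$ be the subgroup of $\mathbb{Z}_n^\times$ generated by $e$. Then the coset index function $f_G$ is an $(mp,\ m(1+t),\ \{0,m(s-1)\})$ zero-difference function.
   Context: For a subgroup $G$ of $\mathbb{Z}_n^\times$ and $r\in\mathbb{Z}_n$, the coset $rG=\{rg\mid g\in G\}$; these cosets partition $\mathbb{Z}_n$, forming a set $D_G$. The coset index function induced by $G$ is $f_G:\mathbb{Z}_n\to\mathbb{Z}_{|D_G|}$, $f_G(x)=h_G(C_x)$, where $C_x$ is the coset containing $x$ and $h_G:D_G\to\mathbb{Z}_{|D_G|}$ is a fixed bijection. A function $f:A\to B$ between finite abelian groups is an $(n,m,S)$ zero-difference function if $n=|A|$, $m=|f(A)|$, and for every nonzero $a\in A$, $|\{x\in A\mid f(x+a)=f(x)\}|\in S$. Here $A=(\mathbb{Z}_n,+)$. -}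

module Defs where

open import Algebra.Bundles using (Monoid; Group; AbelianGroup; CommutativeRing)
open import Algebra.Definitions using (Invertible)
open import Data.Fin.Base using (Fin)
open import Data.Integer.Base using (ℤ; +_; _+_; _*_; -_; _-_; _^_; 0ℤ; 1ℤ)
open import Data.Integer.Divisibility.Signed using (_∣_; divides; ∣m⇒∣-m; ∣m∣n⇒∣m+n; ∣m⇒∣m*n; ∣n⇒∣m*n)
import Data.Integer.Properties as ℤ
open import Data.Integer.Tactic.RingSolver using (solve-∀)
open import Data.Nat.Base as ℕ using (ℕ; zero; suc)
open import Data.Product.Base using (∃; ∃-syntax; _×_; _,_; proj₁; proj₂)
open import Function.Bundles using (Func; Injection; Bijection)
import Function.Construct.Composition as Compose
open import Level using (Level; 0ℓ; _⊔_) renaming (suc to lsuc)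
open import Relation.Binary.Bundles using (Setoid)
open import Relation.Binary.Definitions using (_Respects_)
import Relation.Binary.Construct.On as On
open import Relation.Binary.PropositionalEquality as ≡ using (_≡_; cong; cong₂; subst)
open import Relation.Nullary.Negation using (¬_)
open import Relation.Unary using (Pred; _∈_; _≐_)
open import Relation.Unary.Relation.Binary.Equality using (≐-setoid)

private
  variable
    a b c ℓ ℓ₁ ℓ₂ q r : Level

subsetoid : (S : Setoid a ℓ) → Pred (Setoid.Carrier S) q → Setoid (a ⊔ q) ℓ
subsetoid S P = On.setoid S (proj₁ {B = P})

HasCardinality : Setoid a ℓ → ℕ → Set (a ⊔ ℓ)
HasCardinality S k = Bijection S (≡.setoid (Fin k))

image : {A : Setoid a ℓ₁} {B : Setoid b ℓ₂} → Func A B → Setoid (a ⊔ b ⊔ ℓ₂) ℓ₂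
image {B = B} f = subsetoid B λ y → ∃[ x ] Func.to f x ≈ y
  where open Setoid B using (_≈_)

record IsZeroDifference (A : AbelianGroup a ℓ₁) (B : AbelianGroup b ℓ₂)
    (f : Func (AbelianGroup.setoid A) (AbelianGroup.setoid B))
    (n m : ℕ) (S : Pred ℕ r) : Set (a ⊔ ℓ₁ ⊔ b ⊔ ℓ₂ ⊔ r) where
  private
    module A = AbelianGroup A
    module B = AbelianGroup B
  open Func f using (to)
  field
    ∣A∣≡n       : HasCardinality A.setoid n
    B-finite    : ∃[ k ] HasCardinality B.setoid k
    ∣f[A]∣≡m    : HasCardinality (image f) m
    differences : ∀ d → ¬ (d A.≈ A.ε) →
      ∃[ k ] HasCardinality (subsetoid A.setoid λ x → to (x A.∙ d) B.≈ to x) k × k ∈ S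

record Subgroup (G : Group c ℓ) (q : Level) : Set (c ⊔ ℓ ⊔ lsuc q) where
  open Group G
  field
    Member    : Pred Carrier q
    respects  : Member Respects _≈_
    ε-closed  : ε ∈ Member
    ∙-closed  : ∀ {x y} → x ∈ Member → y ∈ Member → (x ∙ y) ∈ Member
    ⁻¹-closed : ∀ {x} → x ∈ Member → (x ⁻¹) ∈ Member

module _ (G : Group c ℓ) where
  open Group G using (Carrier; _≈_; _∙_; ε; _⁻¹)

  data Generated (e : Carrier) : Pred Carrier (c ⊔ ℓ) where
    generator : e ∈ Generated e
    respects  : (Generated e) Respects _≈_
    identity  : ε ∈ Generated e
    product   : ∀ {x y} → x ∈ Generated e → y ∈ Generated e → (x ∙ y) ∈ Generated e
    inverses  : ∀ {x} → x ∈ Generated e → (x ⁻¹) ∈ Generated e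

  ⟨_⟩ : Carrier → Subgroup G (c ⊔ ℓ)
  ⟨ e ⟩ = record
    { Member    = Generated e
    ; respects  = respects
    ; ε-closed  = identity
    ; ∙-closed  = product
    ; ⁻¹-closed = inverses
    }

  IsGenerator : Carrier → Set (c ⊔ ℓ)
  IsGenerator g = ∀ x → x ∈ Subgroup.Member ⟨ g ⟩

unitGroup : Monoid c ℓ → Group (c ⊔ ℓ) ℓ
unitGroup M = record
  { Carrier = ∃ (Invertible _≈_ ε _∙_)
  ; _≈_     = λ u v → proj₁ u ≈ proj₁ v
  ; _∙_     = λ (x , x′ , x′x , xx′) (y , y′ , y′y , yy′) →
      x ∙ y , y′ ∙ x′ , cancel x′x y′y , cancel yy′ xx′
  ; ε       = ε , ε , identityˡ ε , identityˡ ε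
  ; _⁻¹     = λ (x , x′ , x′x , xx′) → x′ , x , xx′ , x′x
  ; isGroup = record
    { isMonoid = record
      { isSemigroup = record
        { isMagma = record
          { isEquivalence = On.isEquivalence proj₁ isEquivalence
          ; ∙-cong = ∙-cong
          }
        ; assoc = λ _ _ _ → assoc _ _ _
        }
      ; identity = (λ _ → identityˡ _) , (λ _ → identityʳ _)
      }
    ; inverse = (λ (_ , _ , x′x , _) → x′x) , (λ (_ , _ , _ , xx′) → xx′)
    ; ⁻¹-cong = λ { {_ , _ , x′x , _} {_ , _ , _ , yy′} → inv-cong x′x yy′ }
    }
  }
  where
  open Monoid M
  open import Relation.Binary.Reasoning.Setoid setoid

  cancel : ∀ {x x′ y y′} → x′ ∙ x ≈ ε → y′ ∙ y ≈ ε → (y′ ∙ x′) ∙ (x ∙ y) ≈ ε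
  cancel {x} {x′} {y} {y′} x′x y′y = begin
    (y′ ∙ x′) ∙ (x ∙ y)  ≈⟨ assoc y′ x′ (x ∙ y) ⟩
    y′ ∙ (x′ ∙ (x ∙ y))  ≈⟨ ∙-congˡ (assoc x′ x y) ⟨
    y′ ∙ ((x′ ∙ x) ∙ y)  ≈⟨ ∙-congˡ (∙-congʳ x′x) ⟩
    y′ ∙ (ε ∙ y)         ≈⟨ ∙-congˡ (identityˡ y) ⟩
    y′ ∙ y               ≈⟨ y′y ⟩
    ε                    ∎

  inv-cong : ∀ {x x′ y y′} → x′ ∙ x ≈ ε → y ∙ y′ ≈ ε → x ≈ y → x′ ≈ y′
  inv-cong {x} {x′} {y} {y′} x′x yy′ x≈y = begin
    x′              ≈⟨ identityʳ x′ ⟨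
    x′ ∙ ε          ≈⟨ ∙-congˡ yy′ ⟨
    x′ ∙ (y ∙ y′)   ≈⟨ assoc x′ y y′ ⟨
    (x′ ∙ y) ∙ y′   ≈⟨ ∙-congʳ (∙-congˡ x≈y) ⟨
    (x′ ∙ x) ∙ y′   ≈⟨ ∙-congʳ x′x ⟩
    ε ∙ y′          ≈⟨ identityˡ y′ ⟩
    y′              ∎

-- ℤ/ n below has carrier ℤ, with congruence modulo n as its equality; so ℤ/ 0 is
-- ℤ, and only positive moduli give finite groups.

infix 4 _≡_[mod_]

record _≡_[mod_] (x y : ℤ) (n : ℕ) : Set where
  constructor mod
  field n∣x-y : + n ∣ x - y

private
  module _ {n : ℕ} where
    ≡⇒≡mod : ∀ {x y} → x ≡ y → x ≡ y [mod n ]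
    ≡⇒≡mod {x} ≡.refl = mod (divides 0ℤ (ℤ.+-inverseʳ x))

    sym-mod : ∀ {x y} → x ≡ y [mod n ] → y ≡ x [mod n ]
    sym-mod {x} {y} (mod n∣x-y) = mod (subst (+ n ∣_) (flip x y) (∣m⇒∣-m n∣x-y))
      where
      flip : ∀ x y → - (x - y) ≡ y - x
      flip = solve-∀

    trans-mod : ∀ {x y z} → x ≡ y [mod n ] → y ≡ z [mod n ] → x ≡ z [mod n ]
    trans-mod {x} {y} {z} (mod n∣x-y) (mod n∣y-z) =
      mod (subst (+ n ∣_) (split x y z) (∣m∣n⇒∣m+n n∣x-y n∣y-z))
      where
      split : ∀ x y z → (x - y) + (y - z) ≡ x - z
      split = solve-∀

    +-cong-mod : ∀ {x y u v} → x ≡ y [mod n ] → u ≡ v [mod n ] → x + u ≡ y + v [mod n ]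
    +-cong-mod {x} {y} {u} {v} (mod n∣x-y) (mod n∣u-v) =
      mod (subst (+ n ∣_) (split x y u v) (∣m∣n⇒∣m+n n∣x-y n∣u-v))
      where
      split : ∀ x y u v → (x - y) + (u - v) ≡ (x + u) - (y + v)
      split = solve-∀

    *-cong-mod : ∀ {x y u v} → x ≡ y [mod n ] → u ≡ v [mod n ] → x * u ≡ y * v [mod n ]
    *-cong-mod {x} {y} {u} {v} (mod n∣x-y) (mod n∣u-v) =
      mod (subst (+ n ∣_) (split x y u v) (∣m∣n⇒∣m+n (∣m⇒∣m*n u n∣x-y) (∣n⇒∣m*n y n∣u-v)))
      where
      split : ∀ x y u v → (x - y) * u + y * (u - v) ≡ x * u - y * v
      split = solve-∀

    -‿cong-mod : ∀ {x y} → x ≡ y [mod n ] → - x ≡ - y [mod n ]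
    -‿cong-mod {x} {y} (mod n∣x-y) = mod (subst (+ n ∣_) (neg x y) (∣m⇒∣-m n∣x-y))
      where
      neg : ∀ x y → - (x - y) ≡ (- x) - (- y)
      neg = solve-∀

ℤ/_ : ℕ → CommutativeRing 0ℓ 0ℓ
ℤ/ n = record
  { Carrier = ℤ
  ; _≈_ = _≡_[mod n ]
  ; _+_ = _+_
  ; _*_ = _*_
  ; -_  = -_
  ; 0#  = 0ℤ
  ; 1#  = 1ℤ
  ; isCommutativeRing = record
    { isRing = record
      { +-isAbelianGroup = record
        { isGroup = record
          { isMonoid = record
            { isSemigroup = record
              { isMagma = record
                { isEquivalence = record
                  { refl = ≡⇒≡mod ≡.refl ; sym = sym-mod ; trans = trans-mod }
                ; ∙-cong = +-cong-mod
                }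
              ; assoc = λ x y z → ≡⇒≡mod (ℤ.+-assoc x y z)
              }
            ; identity = (λ x → ≡⇒≡mod (ℤ.+-identityˡ x)) , (λ x → ≡⇒≡mod (ℤ.+-identityʳ x))
            }
          ; inverse = (λ x → ≡⇒≡mod (ℤ.+-inverseˡ x)) , (λ x → ≡⇒≡mod (ℤ.+-inverseʳ x))
          ; ⁻¹-cong = -‿cong-mod
          }
        ; comm = λ x y → ≡⇒≡mod (ℤ.+-comm x y)
        }
      ; *-cong = *-cong-mod
      ; *-assoc = λ x y z → ≡⇒≡mod (ℤ.*-assoc x y z)
      ; *-identity = (λ x → ≡⇒≡mod (ℤ.*-identityˡ x)) , (λ x → ≡⇒≡mod (ℤ.*-identityʳ x))
      ; distrib = (λ x y z → ≡⇒≡mod (ℤ.*-distribˡ-+ x y z)) , (λ x y z → ≡⇒≡mod (ℤ.*-distribʳ-+ x y z))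
      }
    ; *-comm = λ x y → ≡⇒≡mod (ℤ.*-comm x y)
    }
  }

ℤ/_+ : ℕ → AbelianGroup 0ℓ 0ℓ
ℤ/ n + = CommutativeRing.+-abelianGroup (ℤ/ n)

ℤ/_ˣ : ℕ → Group 0ℓ 0ℓ
ℤ/ n ˣ = unitGroup (CommutativeRing.*-monoid (ℤ/ n))

module _ {n : ℕ} (G : Subgroup (ℤ/ n ˣ) 0ℓ) where
  open Subgroup G
  open CommutativeRing (ℤ/ n) using (setoid; sym; trans; *-congˡ; *-congʳ; *-assoc; *-identityʳ)
  private module U = Group (ℤ/ n ˣ)

  coset : ℤ → Pred ℤ 0ℓ
  coset r y = ∃[ g ] g ∈ Member × y ≡ r * proj₁ g [mod n ]

  D : Setoid (lsuc 0ℓ) 0ℓ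
  D = subsetoid (≐-setoid ℤ 0ℓ) λ C → ∃[ r ] C ≐ coset r

  ∈-coset : ∀ x → x ∈ coset x
  ∈-coset x = U.ε , ε-closed , sym (*-identityʳ x)

  -- With ∈-coset, this makes coset x the unique coset containing x.
  coset-unique : ∀ {x} ((C , _) : Setoid.Carrier D) → x ∈ C → C ≐ coset x
  coset-unique {x} (C , r , C⊆ , ⊆C) x∈C with C⊆ x∈C
  ... | g , g∈G , x≈rg =
      (λ y∈C → let h , h∈G , y≈rh = C⊆ y∈C in
        g U.⁻¹ U.∙ h , ∙-closed (⁻¹-closed g∈G) h∈G , trans y≈rh (sym (back (proj₁ h))))
    , (λ (h , h∈G , y≈xh) → ⊆C
        ( g U.∙ h , ∙-closed g∈G h∈G
        , trans y≈xh (trans (*-congʳ x≈rg) (*-assoc r (proj₁ g) (proj₁ h)))))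
    where
    g⁻¹ = proj₁ (g U.⁻¹)
    open import Relation.Binary.Reasoning.Setoid setoid
    back : ∀ h → x * (g⁻¹ * h) ≡ r * h [mod n ]
    back h = begin
      x * (g⁻¹ * h)              ≈⟨ *-congʳ x≈rg ⟩
      (r * proj₁ g) * (g⁻¹ * h)  ≡⟨ regroup r (proj₁ g) g⁻¹ h ⟩
      (r * h) * (proj₁ g * g⁻¹)  ≈⟨ *-congˡ {r * h} (U.inverseʳ g) ⟩
      (r * h) * 1ℤ               ≈⟨ *-identityʳ (r * h) ⟩
      r * h                      ∎
      where
      regroup : ∀ r g g′ h → (r * g) * (g′ * h) ≡ (r * h) * (g * g′)
      regroup = solve-∀

  toCoset : Func setoid D
  toCoset = record
    { to   = λ x → coset x , x , (λ z → z) , (λ z → z)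
    ; cong = λ x≈y → resp x≈y , resp (sym x≈y)
    }
    where
    resp : ∀ {x y} → x ≡ y [mod n ] → ∀ {z} → z ∈ coset x → z ∈ coset y
    resp x≈y (g , g∈G , z≈xg) = g , g∈G , trans z≈xg (*-congʳ x≈y)

  cosetIndex : ∀ {k} → Bijection D (AbelianGroup.setoid (ℤ/ k +)) →
               Func setoid (AbelianGroup.setoid (ℤ/ k +))
  cosetIndex h = Compose.function toCoset (Injection.function (Bijection.injection h))

-- A unit e: if v inverts gᵗ modulo p, then m p divides (e - 1)(e v - 1), so
-- 1 + v - e v inverts e modulo m p.
congruenceUnit : ∀ m p t e (g : Group.Carrier (ℤ/ p ˣ)) →
            e ≡ 1ℤ [mod m ] → e ≡ proj₁ g ^ t [mod p ] →
            Group.Carrier (ℤ/ (m ℕ.* p) ˣ)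
congruenceUnit m p t e (g , h , _ , gh≡1) (mod (divides k e-1≡km)) e≡gᵗ =
  e , w , subst (_≡ 1ℤ [mod m ℕ.* p ]) (ℤ.*-comm e w) ew≡1 , ew≡1
  where
  module P = CommutativeRing (ℤ/ p)
  v = h ^ t
  w = 1ℤ + v - e * v

  pow : ∀ t → g ^ t * h ^ t ≡ 1ℤ [mod p ]
  pow zero    = P.refl
  pow (suc t) = subst (_≡ 1ℤ [mod p ]) (regroup g h (g ^ t) (h ^ t)) (P.*-cong gh≡1 (pow t))
    where
    regroup : ∀ g h x y → (g * h) * (x * y) ≡ (g * x) * (h * y)
    regroup = solve-∀

  ew≡1 : e * w ≡ 1ℤ [mod m ℕ.* p ]
  ew≡1 with P.trans (P.*-congʳ e≡gᵗ) (pow t)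
  ... | mod (divides l ev-1≡lp) = mod (divides (- (k * l)) (begin
    e * w - 1ℤ                   ≡⟨ factor e v ⟩
    - ((e - 1ℤ) * (e * v - 1ℤ))  ≡⟨ cong₂ (λ x y → - (x * y)) e-1≡km ev-1≡lp ⟩
    - ((k * + m) * (l * + p))    ≡⟨ regroup k l (+ m) (+ p) ⟩
    - (k * l) * (+ m * + p)      ≡⟨ cong (- (k * l) *_) (ℤ.pos-* m p) ⟨
    - (k * l) * + (m ℕ.* p)      ∎))
    where
    open ≡.≡-Reasoning
    factor : ∀ e v → e * (1ℤ + v - e * v) - 1ℤ ≡ - ((e - 1ℤ) * (e * v - 1ℤ))
    factor = solve-∀
    regroup : ∀ k l m p → - ((k * m) * (l * p)) ≡ - (k * l) * (m * p)
    regroup = solve-∀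

-- By the Chinese remainder theorem an element of ℤ/mp is a pair in ℤ/m × ℤ/p, on which e acts
-- as (1, γᵗ) for the generator γ of (ℤ/p)ˣ, so that G is {(1, γᵗⁱ) ∣ 0 ≤ i < s}. Hence y ∈ xG
-- iff y ≡ x mod m and y ≡ x γᵗⁱ mod p for some i < s. The orbits of γᵗ on ℤ/p are {0} and those
-- of γʲ for j < t, which gives the m(1 + t) cosets. For d ≠ 0, the relation x + d ∈ xG forces
-- d ≡ 0 mod m, and then x (γᵗⁱ − 1) ≡ d mod p: one x mod p for each 0 < i < s, and x mod m is
-- free.
--
-- That γ has order exactly q = p − 1 is a counting argument: the pigeonhole principle gives
-- γʳ ≡ 1 for some 0 < r ≤ q, while γʳ ≡ 1 with r > 0 makes the q nonzero residues inject
-- into the r exponents below r.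

module Submission where

open import Defs
open import Algebra.Bundles using (Group; AbelianGroup; CommutativeRing)
open import Data.Fin.Base as Fin using (Fin; toℕ; fromℕ<; combine; remQuot; punchOut)
open import Data.Fin.Properties as Fin using (toℕ<n; toℕ-fromℕ<; toℕ-injective; combine-remQuot; pigeonhole; injective⇒≤; punchOut-injective)
open import Data.Integer.Base as ℤ using (ℤ; +_; 0ℤ; 1ℤ; _^_)
open import Data.Integer.DivMod using (_%ℕ_; _/ℕ_; n%ℕd<d; a≡a%ℕn+[a/ℕn]*n)
open import Data.Integer.Divisibility.Signed as ℤ using (divides; _∣?_; ∣⇒∣ᵤ; ∣ᵤ⇒∣)
import Data.Integer.Properties as ℤ
open import Data.Integer.Tactic.RingSolver using (solve-∀)
open import Data.Nat.Base using (ℕ; zero; suc; _+_; _*_; _∸_; _⊔_; _<_; _≤_; NonZero; s<s; >-nonZero; >-nonZero⁻¹; ≢-nonZero)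
open import Data.Nat.Coprimality using (Coprime; gcd≡1⇒coprime; coprime-Bézout; prime⇒coprime)
open import Data.Nat.Divisibility using (_∣_; ∣⇒≤; ∣1⇒≡1; m∣m*n; n∣m*n)
open import Data.Nat.DivMod using (_/_; _%_; m%n<n; m≡m%n+[m/n]*n)
open import Data.Nat.GCD using (gcd; module Bézout)
open import Data.Nat.Primality using (Prime; ¬prime[0]; ¬prime[1]; prime⇒nonZero)
import Data.Nat.Properties as ℕ
open import Data.Product.Base using (∃-syntax; ∃₂; _×_; _,_; proj₁; proj₂; uncurry)
open import Data.Sum.Base using (inj₁; inj₂)
open import Function.Base using (_∘_)
open import Function.Bundles using (Bijection; Func)
open import Level using (0ℓ)
open import Relation.Binary.Bundles using (Setoid)
open import Relation.Binary.Definitions using (tri<; tri≈; tri>)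
open import Relation.Binary.PropositionalEquality using (_≡_; _≢_; refl; sym; trans; cong; cong₂; subst; module ≡-Reasoning)
import Relation.Binary.Reasoning.Setoid as SetoidReasoning
open import Relation.Nullary.Decidable using (Dec; yes; no; map′)
open import Relation.Nullary.Negation using (¬_; contradiction)
open import Relation.Unary using (_∈_; _∪_; ｛_｝)

private module ℤMod (n : ℕ) = CommutativeRing (ℤ/ n)

-- Counting a setoid by enumerating it

module _ {a ℓ} (S : Setoid a ℓ) where
  open Setoid S using (Carrier; _≈_) renaming (sym to ≈-sym; trans to ≈-trans)

  -- The index chosen by `surjective` need not respect `≈` on its own; injectivity of `from` makes
  -- it congruent and a two-sided inverse.
  cardinality : ∀ {k} (from : Fin k → Carrier) →
    (∀ {i j} → from i ≈ from j → i ≡ j) → (∀ x → ∃[ i ] from i ≈ x) →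
    HasCardinality S k
  cardinality from injective surjective = record
    { to        = index
    ; cong      = λ {x} {y} x≈y → injective
        (≈-trans (from-index x) (≈-trans x≈y (≈-sym (from-index y))))
    ; bijective =
        (λ {x} {y} eq → ≈-trans (≈-sym (from-index x))
          (subst (λ i → from i ≈ y) (sym eq) (from-index y)))
      , λ i → from i , λ {x} x≈ → injective (≈-trans (from-index x) x≈)
    }
    where
    index = proj₁ ∘ surjective
    from-index = proj₂ ∘ surjective

  cardinality-× : ∀ {k l} (from : Fin k → Fin l → Carrier) →
    (∀ {i i′ j j′} → from i j ≈ from i′ j′ → i ≡ i′ × j ≡ j′) →
    (∀ x → ∃₂ λ i j → from i j ≈ x) →
    HasCardinality S (k * l)
  cardinality-× {k} {l} from injective surjective = cardinality
    (uncurry from ∘ remQuot l)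
    (λ {i} {j} eq → let eq₁ , eq₂ = injective eq in
      trans (sym (combine-remQuot {k} l i))
        (trans (cong₂ combine eq₁ eq₂) (combine-remQuot {k} l j)))
    λ x → let i , j , eq = surjective x in
      combine i j , subst (λ ij → uncurry from ij ≈ x) (sym (Fin.remQuot-combine i j)) eq

-- Residues modulo `n`

mod-∣ : ∀ {m n x y} → m ∣ n → x ≡ y [mod n ] → x ≡ y [mod m ]
mod-∣ m∣n (mod n∣x-y) = mod (ℤ.∣-trans (∣ᵤ⇒∣ m∣n) n∣x-y)

_≟_[mod_] : ∀ x y n → Dec (x ≡ y [mod n ])
x ≟ y [mod n ] = map′ mod (λ (mod n∣x-y) → n∣x-y) (+ n ∣? x ℤ.- y)

-- Two numbers below `n` differ by less than `n` in absolute value, and the only multiple of `n`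
-- that small is 0.
toℕ-injective-mod : ∀ {n} {i j : Fin n} → + toℕ i ≡ + toℕ j [mod n ] → i ≡ j
toℕ-injective-mod {n} {i} {j} (mod n∣i-j) =
  toℕ-injective (ℤ.+-injective (ℤ.i-j≡0⇒i≡j _ _ (ℤ.∣i∣≡0⇒i≡0 (multiple-zero (∣⇒∣ᵤ n∣i-j) bound))))
  where
  multiple-zero : ∀ {k} → n ∣ k → k < n → k ≡ 0
  multiple-zero {zero}  _   _   = refl
  multiple-zero {suc _} n∣k k<n = contradiction (∣⇒≤ n∣k) (ℕ.<⇒≱ k<n)

  bound : ℤ.∣ + toℕ i ℤ.- + toℕ j ∣ < n
  bound = ℕ.≤-<-trans
    (subst (λ z → ℤ.∣ z ∣ ≤ toℕ i ⊔ toℕ j) (sym (ℤ.m-n≡m⊖n (toℕ i) (toℕ j))) (ℤ.∣m⊝n∣≤m⊔n (toℕ i) (toℕ j)))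
    (ℕ.⊔-lub (toℕ<n i) (toℕ<n j))

residue : ∀ n .{{_ : NonZero n}} x → ∃[ i ] + toℕ {n} i ≡ x [mod n ]
residue n x = fromℕ< (n%ℕd<d x n) , ℤMod.sym n (mod (divides (x /ℕ n) (begin
  x ℤ.- + toℕ (fromℕ< (n%ℕd<d x n))                   ≡⟨ cong (λ r → x ℤ.- + r) (toℕ-fromℕ< (n%ℕd<d x n)) ⟩
  x ℤ.- + (x %ℕ n)                                    ≡⟨ cong (ℤ._- + (x %ℕ n)) (a≡a%ℕn+[a/ℕn]*n x n) ⟩
  (+ (x %ℕ n) ℤ.+ (x /ℕ n) ℤ.* + n) ℤ.- + (x %ℕ n)    ≡⟨ cancel (+ (x %ℕ n)) ((x /ℕ n) ℤ.* + n) ⟩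
  (x /ℕ n) ℤ.* + n                                    ∎)))
  where
  open ≡-Reasoning
  cancel : ∀ a b → (a ℤ.+ b) ℤ.- a ≡ b
  cancel = solve-∀

ℤ/-cardinality : ∀ n .{{_ : NonZero n}} → HasCardinality (ℤMod.setoid n) n
ℤ/-cardinality n = cardinality (ℤMod.setoid n) (+_ ∘ toℕ) toℕ-injective-mod (residue n)

-- Bézout coefficients and the Chinese remainder theorem

private
  bézout-signed : ∀ a b x y → 1 + y * b ≡ x * a → + x ℤ.* + a ℤ.+ (ℤ.- + y) ℤ.* + b ≡ 1ℤ
  bézout-signed a b x y eq = begin
    + x ℤ.* + a ℤ.+ (ℤ.- + y) ℤ.* + b           ≡⟨ cong (ℤ._+ (ℤ.- + y) ℤ.* + b) (ℤ.pos-* x a) ⟨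
    + (x * a) ℤ.+ (ℤ.- + y) ℤ.* + b             ≡⟨ cong (λ z → + z ℤ.+ (ℤ.- + y) ℤ.* + b) eq ⟨
    1ℤ ℤ.+ + (y * b) ℤ.+ (ℤ.- + y) ℤ.* + b      ≡⟨ cong (λ z → 1ℤ ℤ.+ z ℤ.+ (ℤ.- + y) ℤ.* + b) (ℤ.pos-* y b) ⟩
    1ℤ ℤ.+ + y ℤ.* + b ℤ.+ (ℤ.- + y) ℤ.* + b    ≡⟨ cancel (+ y) (+ b) ⟩
    1ℤ                                          ∎
    where
    open ≡-Reasoning
    cancel : ∀ y b → 1ℤ ℤ.+ y ℤ.* b ℤ.+ (ℤ.- y) ℤ.* b ≡ 1ℤ
    cancel = solve-∀

bézout : ∀ {a b} → Coprime a b → ∃₂ λ u v → u ℤ.* + a ℤ.+ v ℤ.* + b ≡ 1ℤ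
bézout {a} {b} a⊥b with coprime-Bézout a⊥b
... | Bézout.+- x y eq = + x , ℤ.- + y , bézout-signed a b x y eq
... | Bézout.-+ x y eq = ℤ.- + x , + y , trans (ℤ.+-comm ((ℤ.- + x) ℤ.* + a) (+ y ℤ.* + b)) (bézout-signed b a y x eq)

module _ {m n : ℕ} (m⊥n : Coprime m n) where
  private
    u = proj₁ (bézout m⊥n)
    v = proj₁ (proj₂ (bézout m⊥n))
    um+vn≡1 = proj₂ (proj₂ (bézout m⊥n))

  crt : ∀ a b → ∃[ x ] x ≡ a [mod m ] × x ≡ b [mod n ]
  crt a b = x ,
    mod (divides ((b ℤ.- a) ℤ.* u) (trans (cong (λ z → x ℤ.- z) (scale a)) (reduceˡ a b u v (+ m) (+ n)))) ,
    mod (divides ((a ℤ.- b) ℤ.* v) (trans (cong (λ z → x ℤ.- z) (scale b)) (reduceʳ a b u v (+ m) (+ n))))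
    where
    -- Since `u m + v n = 1`, the number `v n` is 1 modulo `m` and 0 modulo `n`, and `u m` is the
    -- reverse.
    x = a ℤ.* (v ℤ.* + n) ℤ.+ b ℤ.* (u ℤ.* + m)
    scale : ∀ a → a ≡ a ℤ.* (u ℤ.* + m ℤ.+ v ℤ.* + n)
    scale a = sym (trans (cong (a ℤ.*_) um+vn≡1) (ℤ.*-identityʳ a))
    reduceˡ : ∀ a b u v m n → (a ℤ.* (v ℤ.* n) ℤ.+ b ℤ.* (u ℤ.* m)) ℤ.- a ℤ.* (u ℤ.* m ℤ.+ v ℤ.* n) ≡ (b ℤ.- a) ℤ.* u ℤ.* m
    reduceˡ = solve-∀
    reduceʳ : ∀ a b u v m n → (a ℤ.* (v ℤ.* n) ℤ.+ b ℤ.* (u ℤ.* m)) ℤ.- b ℤ.* (u ℤ.* m ℤ.+ v ℤ.* n) ≡ (a ℤ.- b) ℤ.* v ℤ.* n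
    reduceʳ = solve-∀

  crt-unique : ∀ {x y} → x ≡ y [mod m ] → x ≡ y [mod n ] → x ≡ y [mod m * n ]
  crt-unique {x} {y} (mod (divides k x-y≡km)) (mod (divides l x-y≡ln)) =
    mod (divides (l ℤ.* u ℤ.+ k ℤ.* v) (begin
      x ℤ.- y                                                     ≡⟨ ℤ.*-identityʳ (x ℤ.- y) ⟨
      -- Expanding 1 as `u m + v n` lets each summand supply one modulus while `x - y` supplies the
      -- other.
      (x ℤ.- y) ℤ.* 1ℤ                                            ≡⟨ cong ((x ℤ.- y) ℤ.*_) um+vn≡1 ⟨
      (x ℤ.- y) ℤ.* (u ℤ.* + m ℤ.+ v ℤ.* + n)                     ≡⟨ ℤ.*-distribˡ-+ (x ℤ.- y) (u ℤ.* + m) (v ℤ.* + n) ⟩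
      (x ℤ.- y) ℤ.* (u ℤ.* + m) ℤ.+ (x ℤ.- y) ℤ.* (v ℤ.* + n)     ≡⟨ cong₂ (λ z w → z ℤ.* (u ℤ.* + m) ℤ.+ w ℤ.* (v ℤ.* + n)) x-y≡ln x-y≡km ⟩
      l ℤ.* + n ℤ.* (u ℤ.* + m) ℤ.+ k ℤ.* + m ℤ.* (v ℤ.* + n)     ≡⟨ regroup k l u v (+ m) (+ n) ⟩
      (l ℤ.* u ℤ.+ k ℤ.* v) ℤ.* (+ m ℤ.* + n)                     ≡⟨ cong ((l ℤ.* u ℤ.+ k ℤ.* v) ℤ.*_) (ℤ.pos-* m n) ⟨
      (l ℤ.* u ℤ.+ k ℤ.* v) ℤ.* + (m * n)                         ∎))
    where
    open ≡-Reasoning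
    regroup : ∀ k l u v m n → l ℤ.* n ℤ.* (u ℤ.* m) ℤ.+ k ℤ.* m ℤ.* (v ℤ.* n) ≡ (l ℤ.* u ℤ.+ k ℤ.* v) ℤ.* (m ℤ.* n)
    regroup = solve-∀

-- Powers and cyclic subgroups of units

^-cong-mod : ∀ {n x y} k → x ≡ y [mod n ] → x ^ k ≡ y ^ k [mod n ]
^-cong-mod {n} zero    x≡y = ℤMod.refl n
^-cong-mod {n} (suc k) x≡y = ℤMod.*-cong n x≡y (^-cong-mod k x≡y)

1^-mod : ∀ {n x} k → x ≡ 1ℤ [mod n ] → x ^ k ≡ 1ℤ [mod n ]
1^-mod {n} {x} k x≡1 = subst (x ^ k ≡_[mod n ]) (ℤ.^-zeroˡ k) (^-cong-mod k x≡1)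

*-cancelˡ-mod : ∀ {n} x w {y z} → x ℤ.* w ≡ 1ℤ [mod n ] → x ℤ.* y ≡ x ℤ.* z [mod n ] → y ≡ z [mod n ]
*-cancelˡ-mod {n} x w {y} {z} xw≡1 xy≡xz = begin
  y                ≈⟨ expand y ⟨
  w ℤ.* (x ℤ.* y)  ≈⟨ ℤMod.*-congˡ n {w} xy≡xz ⟩
  w ℤ.* (x ℤ.* z)  ≈⟨ expand z ⟩
  z                ∎
  where
  open SetoidReasoning (ℤMod.setoid n)
  regroup : ∀ x w y → w ℤ.* (x ℤ.* y) ≡ x ℤ.* w ℤ.* y
  regroup = solve-∀
  expand : ∀ y → w ℤ.* (x ℤ.* y) ≡ y [mod n ]
  expand y = begin
    w ℤ.* (x ℤ.* y)  ≡⟨ regroup x w y ⟩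
    x ℤ.* w ℤ.* y    ≈⟨ ℤMod.*-congʳ n xw≡1 ⟩
    1ℤ ℤ.* y         ≡⟨ ℤ.*-identityˡ y ⟩
    y                ∎

module _ {n : ℕ} (u : Group.Carrier (ℤ/ n ˣ)) where
  private module U = Group (ℤ/ n ˣ)

  ^∈Generated : ∀ i → ∃[ v ] v ∈ Generated (ℤ/ n ˣ) u × proj₁ v ≡ proj₁ u ^ i
  ^∈Generated zero    = U.ε , identity , refl
  ^∈Generated (suc i) = let v , v∈ , eq = ^∈Generated i in
    u U.∙ v , product generator v∈ , cong (proj₁ u ℤ.*_) eq

  module _ {r : ℕ} .{{_ : NonZero r}} (uʳ≡1 : proj₁ u ^ r ≡ 1ℤ [mod n ]) where
    ^-%-mod : ∀ i → proj₁ u ^ i ≡ proj₁ u ^ (i % r) [mod n ]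
    ^-%-mod i = begin
      proj₁ u ^ i                                    ≡⟨ cong (proj₁ u ^_) (trans (m≡m%n+[m/n]*n i r) (cong (λ j → i % r + j) (ℕ.*-comm (i / r) r))) ⟩
      proj₁ u ^ (i % r + r * (i / r))                ≡⟨ ℤ.^-distribˡ-+-* (proj₁ u) (i % r) _ ⟩
      proj₁ u ^ (i % r) ℤ.* proj₁ u ^ (r * (i / r))  ≡⟨ cong (proj₁ u ^ (i % r) ℤ.*_) (ℤ.^-*-assoc (proj₁ u) r (i / r)) ⟨
      proj₁ u ^ (i % r) ℤ.* (proj₁ u ^ r) ^ (i / r)  ≈⟨ ℤMod.*-congˡ n {proj₁ u ^ (i % r)} (1^-mod (i / r) uʳ≡1) ⟩
      proj₁ u ^ (i % r) ℤ.* 1ℤ                       ≡⟨ ℤ.*-identityʳ _ ⟩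
      proj₁ u ^ (i % r)                              ∎
      where open SetoidReasoning (ℤMod.setoid n)

    Generated⇒^ : ∀ {v} → v ∈ Generated (ℤ/ n ˣ) u → ∃[ i ] proj₁ v ≡ proj₁ u ^ i [mod n ]
    Generated⇒^ generator = 1 , ℤMod.reflexive n (sym (ℤ.^-identityʳ (proj₁ u)))
    Generated⇒^ (respects x≈y x∈) = let i , eq = Generated⇒^ x∈ in
      i , ℤMod.trans n (ℤMod.sym n x≈y) eq
    Generated⇒^ identity = 0 , ℤMod.refl n
    Generated⇒^ (product x∈ y∈) = let i , eq₁ = Generated⇒^ x∈ ; j , eq₂ = Generated⇒^ y∈ in
      i + j , ℤMod.trans n (ℤMod.*-cong n eq₁ eq₂) (ℤMod.reflexive n (sym (ℤ.^-distribˡ-+-* (proj₁ u) i j)))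
    Generated⇒^ (inverses {x , x′ , x′x≡1 , xx′≡1} x∈) = let i , eq = Generated⇒^ x∈ in
      -- The inverse of `uⁱ` is the natural power with exponent `i (r - 1)`, because the two
      -- exponents add up to `r i` and `uʳ ≡ 1`.
      i * (r ∸ 1) , *-cancelˡ-mod x x′ xx′≡1 (begin
        x ℤ.* x′                                      ≈⟨ xx′≡1 ⟩
        1ℤ                                            ≈⟨ 1^-mod i uʳ≡1 ⟨
        (proj₁ u ^ r) ^ i                             ≡⟨ ℤ.^-*-assoc (proj₁ u) r i ⟩
        proj₁ u ^ (r * i)                             ≡⟨ cong (proj₁ u ^_) (trans (cong (_* i) (sym (ℕ.suc-pred r))) (trans (ℕ.*-comm (suc (r ∸ 1)) i) (ℕ.*-suc i (r ∸ 1)))) ⟩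
        proj₁ u ^ (i + i * (r ∸ 1))                   ≡⟨ ℤ.^-distribˡ-+-* (proj₁ u) i _ ⟩
        proj₁ u ^ i ℤ.* proj₁ u ^ (i * (r ∸ 1))       ≈⟨ ℤMod.*-congʳ n eq ⟨
        x ℤ.* proj₁ u ^ (i * (r ∸ 1))                 ∎)
      where open SetoidReasoning (ℤMod.setoid n)

    Generated⇒^< : ∀ {v} → v ∈ Generated (ℤ/ n ˣ) u → ∃[ i ] i < r × proj₁ v ≡ proj₁ u ^ i [mod n ]
    Generated⇒^< v∈ = let i , eq = Generated⇒^ v∈ in
      i % r , m%n<n i r , ℤMod.trans n eq (^-%-mod i)

^-inverse-mod : ∀ {n x w} k → x ℤ.* w ≡ 1ℤ [mod n ] → x ^ k ℤ.* w ^ k ≡ 1ℤ [mod n ]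
^-inverse-mod {n} {x} {w} zero    xw≡1 = ℤMod.refl n
^-inverse-mod {n} {x} {w} (suc k) xw≡1 = subst (_≡ 1ℤ [mod n ]) (interchange x w (x ^ k) (w ^ k))
  (ℤMod.*-cong n xw≡1 (^-inverse-mod k xw≡1))
  where
  interchange : ∀ a b c d → (a ℤ.* b) ℤ.* (c ℤ.* d) ≡ (a ℤ.* c) ℤ.* (b ℤ.* d)
  interchange = solve-∀

-- Translation, scaling and cancellation of residues

+-cancelʳ-mod : ∀ {n x y} z → x ℤ.+ z ≡ y ℤ.+ z [mod n ] → x ≡ y [mod n ]
+-cancelʳ-mod {n} {x} {y} z (mod n∣) = mod (subst (+ n ℤ.∣_) (cancel x y z) n∣)
  where
  cancel : ∀ x y z → (x ℤ.+ z) ℤ.- (y ℤ.+ z) ≡ x ℤ.- y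
  cancel = solve-∀

translate-fixed : ∀ {n d} x → x ℤ.+ d ≡ x [mod n ] → d ≡ 0ℤ [mod n ]
translate-fixed {n} {d} x (mod n∣) = mod (subst (+ n ℤ.∣_) (cancel x d) n∣)
  where
  cancel : ∀ x d → (x ℤ.+ d) ℤ.- x ≡ d ℤ.- 0ℤ
  cancel = solve-∀

translate-by-0 : ∀ {n d} x → d ≡ 0ℤ [mod n ] → x ℤ.+ d ≡ x [mod n ]
translate-by-0 {n} {d} x d≡0 = ℤMod.trans n (ℤMod.+-congˡ n {x} d≡0) (ℤMod.+-identityʳ n x)

-- Turns the condition that translation by `d` acts on `x` as multiplication by `c` into a linear
-- equation for `x`.
translate-scale : ∀ {n d} x c → x ℤ.+ d ≡ x ℤ.* c [mod n ] → x ℤ.* (c ℤ.- 1ℤ) ≡ d [mod n ]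
translate-scale {n} {d} x c (mod n∣) = ℤMod.sym n (mod (subst (+ n ℤ.∣_) (regroup x c d) n∣))
  where
  regroup : ∀ x c d → (x ℤ.+ d) ℤ.- x ℤ.* c ≡ d ℤ.- x ℤ.* (c ℤ.- 1ℤ)
  regroup = solve-∀

scale-translate : ∀ {n d} x c → x ℤ.* (c ℤ.- 1ℤ) ≡ d [mod n ] → x ℤ.+ d ≡ x ℤ.* c [mod n ]
scale-translate {n} {d} x c (mod n∣) = ℤMod.sym n (mod (subst (+ n ℤ.∣_) (regroup x c d) n∣))
  where
  regroup : ∀ x c d → x ℤ.* (c ℤ.- 1ℤ) ℤ.- d ≡ x ℤ.* c ℤ.- (x ℤ.+ d)
  regroup = solve-∀

^-∸-mod : ∀ {n} x w {i j} → x ℤ.* w ≡ 1ℤ [mod n ] → i ≤ j → x ^ i ≡ x ^ j [mod n ] → x ^ (j ∸ i) ≡ 1ℤ [mod n ]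
^-∸-mod {n} x w {i} {j} xw≡1 i≤j xⁱ≡xʲ = *-cancelˡ-mod (x ^ i) (w ^ i) (^-inverse-mod i xw≡1) (begin
  x ^ i ℤ.* x ^ (j ∸ i)  ≡⟨ ℤ.^-distribˡ-+-* x i (j ∸ i) ⟨
  x ^ (i + (j ∸ i))      ≡⟨ cong (x ^_) (ℕ.m+[n∸m]≡n i≤j) ⟩
  x ^ j                  ≈⟨ xⁱ≡xʲ ⟨
  x ^ i                  ≡⟨ ℤ.*-identityʳ (x ^ i) ⟨
  x ^ i ℤ.* 1ℤ           ∎)
  where open SetoidReasoning (ℤMod.setoid n)

-- Units modulo a prime

prime⇒pred-nonZero : ∀ {q} → Prime (suc q) → NonZero q
prime⇒pred-nonZero p-prime = ≢-nonZero λ { refl → ¬prime[1] p-prime }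

module _ {p : ℕ} (p-prime : Prime p) where
  private instance
    p-nonZero : NonZero p
    p-nonZero = prime⇒nonZero p-prime

  1≢0-mod-prime : ¬ 1ℤ ≡ 0ℤ [mod p ]
  1≢0-mod-prime (mod p∣1) = ¬prime[1] (subst Prime (∣1⇒≡1 (∣⇒∣ᵤ p∣1)) p-prime)

  unit⇒≢0 : ∀ x w → x ℤ.* w ≡ 1ℤ [mod p ] → ¬ x ≡ 0ℤ [mod p ]
  unit⇒≢0 x w xw≡1 x≡0 = 1≢0-mod-prime (ℤMod.trans p (ℤMod.sym p xw≡1) (ℤMod.*-congʳ p {w} x≡0))

  -- The residue of `x` is positive and below `p`, hence coprime to `p`; its Bézout coefficient is
  -- the inverse.
  ≢0⇒unit : ∀ x → ¬ x ≡ 0ℤ [mod p ] → ∃[ w ] x ℤ.* w ≡ 1ℤ [mod p ]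
  ≢0⇒unit x x≢0 with residue p x
  ... | r , r≡x with toℕ r in eq
  ...   | zero  = contradiction (ℤMod.sym p r≡x) x≢0
  ...   | suc k with bézout (prime⇒coprime p-prime (subst (_< p) eq (toℕ<n r)))
  ...     | u , v , up+vk≡1 = v , (begin
    x ℤ.* v        ≈⟨ ℤMod.*-congʳ p {v} r≡x ⟨
    + suc k ℤ.* v  ≈⟨ mod (divides (ℤ.- u) (trans (cong (λ z → + suc k ℤ.* v ℤ.- z) (sym up+vk≡1)) (cancel u v (+ p) (+ suc k)))) ⟩
    1ℤ             ∎)
    where
    open SetoidReasoning (ℤMod.setoid p)
    cancel : ∀ u v p k → k ℤ.* v ℤ.- (u ℤ.* p ℤ.+ v ℤ.* k) ≡ (ℤ.- u) ℤ.* p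
    cancel = solve-∀

-- The order of a generator modulo a prime

module _ {q : ℕ} (p-prime : Prime (suc q)) (g : Group.Carrier (ℤ/ suc q ˣ))
         (g-generates : IsGenerator (ℤ/ suc q ˣ) g) where
  private
    p = suc q
    γ = proj₁ g
    γ⁻¹ = proj₁ (proj₂ g)
    γγ⁻¹≡1 = proj₂ (proj₂ (proj₂ g))
    instance
      q-nonZero : NonZero q
      q-nonZero = prime⇒pred-nonZero p-prime

  generator^≢0 : ∀ i → ¬ γ ^ i ≡ 0ℤ [mod p ]
  generator^≢0 i = unit⇒≢0 p-prime (γ ^ i) (γ⁻¹ ^ i) (^-inverse-mod i γγ⁻¹≡1)

  -- A discrete logarithm for any `r` with `γʳ ≡ 1`: the bound on the order uses it before the order
  -- is known.
  log : ∀ r .{{_ : NonZero r}} → γ ^ r ≡ 1ℤ [mod p ] →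
    ∀ x → ¬ x ≡ 0ℤ [mod p ] → ∃[ i ] i < r × x ≡ γ ^ i [mod p ]
  log r γʳ≡1 x x≢0 = let w , xw≡1 = ≢0⇒unit p-prime x x≢0 in
    Generated⇒^< g γʳ≡1 (g-generates
      (x , w , subst (_≡ 1ℤ [mod p ]) (ℤ.*-comm x w) xw≡1 , xw≡1))

  -- A residue is recovered from its logarithm, so logarithms are injective; `Fin.suc` lets `Fin q`
  -- index the nonzero residues.
  order-≥ : ∀ {r} .{{_ : NonZero r}} → γ ^ r ≡ 1ℤ [mod p ] → q ≤ r
  order-≥ {r} γʳ≡1 = injective⇒≤ {f = λ a → fromℕ< (proj₁ (proj₂ (logs a)))} λ {a} {b} eq →
    Fin.suc-injective (toℕ-injective-mod (ℤMod.trans p (proj₂ (proj₂ (logs a)))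
      (ℤMod.trans p (ℤMod.reflexive p (cong (γ ^_) (Fin.fromℕ<-injective _ _ _ _ eq)))
        (ℤMod.sym p (proj₂ (proj₂ (logs b)))))))
    where
    logs : ∀ (a : Fin q) → ∃[ i ] i < r × + toℕ (Fin.suc a) ≡ γ ^ i [mod p ]
    logs a = log r γʳ≡1 (+ toℕ (Fin.suc a)) λ a≡0 →
      Fin.0≢1+n (sym (toℕ-injective-mod {i = Fin.suc a} {j = Fin.zero} a≡0))

  ∸-order-≥ : ∀ {i j} → i < j → γ ^ i ≡ γ ^ j [mod p ] → q ≤ j ∸ i
  ∸-order-≥ i<j γⁱ≡γʲ = order-≥ {{>-nonZero (ℕ.m<n⇒0<n∸m i<j)}} (^-∸-mod γ γ⁻¹ γγ⁻¹≡1 (ℕ.<⇒≤ i<j) γⁱ≡γʲ)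

  private
    residue-^ : Fin p → Fin p
    residue-^ i = proj₁ (residue p (γ ^ toℕ i))

    residue-^-≡ : ∀ i → + toℕ (residue-^ i) ≡ γ ^ toℕ i [mod p ]
    residue-^-≡ i = proj₂ (residue p (γ ^ toℕ i))

    residue-^≢0 : ∀ i → Fin.zero ≢ residue-^ i
    residue-^≢0 i eq = generator^≢0 (toℕ i)
      (ℤMod.trans p (ℤMod.sym p (residue-^-≡ i)) (ℤMod.reflexive p (cong (+_ ∘ toℕ) (sym eq))))

    residue-^-collision : ∀ {i j} → residue-^ i ≡ residue-^ j → γ ^ toℕ i ≡ γ ^ toℕ j [mod p ]
    residue-^-collision {i} {j} eq = ℤMod.trans p (ℤMod.sym p (residue-^-≡ i))
      (ℤMod.trans p (ℤMod.reflexive p (cong (+_ ∘ toℕ) eq)) (residue-^-≡ j))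

  -- The `q + 1` powers with exponents from 0 to `q` avoid the residue 0, so two of them agree.
  -- Their exponents differ by at most `q`, and by `∸-order-≥` at least `q`, hence by exactly `q`.
  generator^order≡1 : γ ^ q ≡ 1ℤ [mod p ]
  generator^order≡1 =
    let i , j , i<j , eq = pigeonhole (ℕ.n<1+n q) (λ i → punchOut (residue-^≢0 i))
        γⁱ≡γʲ = residue-^-collision {i} {j} (punchOut-injective (residue-^≢0 i) (residue-^≢0 j) eq)
        j∸i≤q = ℕ.≤-trans (ℕ.m∸n≤m (toℕ j) (toℕ i)) (Fin.toℕ≤pred[n] j)
    in subst (λ r → γ ^ r ≡ 1ℤ [mod p ]) (ℕ.≤-antisym j∸i≤q (∸-order-≥ i<j γⁱ≡γʲ))
      (^-∸-mod γ γ⁻¹ γγ⁻¹≡1 (ℕ.<⇒≤ i<j) γⁱ≡γʲ)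

  generator^-injective : ∀ {i j} → i < q → j < q → γ ^ i ≡ γ ^ j [mod p ] → i ≡ j
  generator^-injective {i} {j} i<q j<q γⁱ≡γʲ with ℕ.<-cmp i j
  ... | tri≈ _ i≡j _ = i≡j
  ... | tri< i<j _ _ = contradiction (∸-order-≥ i<j γⁱ≡γʲ) (ℕ.<⇒≱ (ℕ.≤-<-trans (ℕ.m∸n≤m j i) j<q))
  ... | tri> _ _ j<i = contradiction (∸-order-≥ j<i (ℤMod.sym p γⁱ≡γʲ)) (ℕ.<⇒≱ (ℕ.≤-<-trans (ℕ.m∸n≤m i j) i<q))

-- Cosets of `G` in Chinese remainder coordinates

-- The informal s, which is the order of G, is suc s here.
module _ {m q n : ℕ} .{{_ : NonZero m}} (p-prime : Prime (suc q)) (m⊥p : Coprime m (suc q))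
         (n≡m*p : n ≡ m * suc q)
         {s t : ℕ} .{{_ : NonZero t}} (1+s*t≡q : suc s * t ≡ q)
         (g : Group.Carrier (ℤ/ suc q ˣ)) (g-generates : IsGenerator (ℤ/ suc q ˣ) g)
         (u : Group.Carrier (ℤ/ n ˣ))
         (u≡1 : proj₁ u ≡ 1ℤ [mod m ]) (u≡gᵗ : proj₁ u ≡ proj₁ g ^ t [mod suc q ]) where
  private
    instance
      q-nonZero : NonZero q
      q-nonZero = prime⇒pred-nonZero p-prime
    p = suc q
    γ = proj₁ g
    e = proj₁ u
    G : Subgroup (ℤ/ n ˣ) 0ℓ
    G = ⟨_⟩ (ℤ/ n ˣ) u

    recombine : ∀ {x y} → x ≡ y [mod m ] → x ≡ y [mod p ] → x ≡ y [mod n ]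
    recombine x≡y x≡y′ = subst (λ n → _ ≡ _ [mod n ]) (sym n≡m*p) (crt-unique m⊥p x≡y x≡y′)

    modˡ : ∀ {x y} → x ≡ y [mod n ] → x ≡ y [mod m ]
    modˡ = mod-∣ (subst (m ∣_) (sym n≡m*p) (m∣m*n p))

    modʳ : ∀ {x y} → x ≡ y [mod n ] → x ≡ y [mod p ]
    modʳ = mod-∣ (subst (p ∣_) (sym n≡m*p) (n∣m*n m))

  e^-modʳ : ∀ i → e ^ i ≡ γ ^ (t * i) [mod p ]
  e^-modʳ i = ℤMod.trans p (^-cong-mod i u≡gᵗ) (ℤMod.reflexive p (ℤ.^-*-assoc γ t i))

  -- Modulo `m` the base is already 1; modulo `p` the power is `γ` to the `t (s + 1) = q`.
  e^1+s≡1 : e ^ suc s ≡ 1ℤ [mod n ]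
  e^1+s≡1 = recombine (1^-mod (suc s) u≡1) (ℤMod.trans p (e^-modʳ (suc s))
    (subst (λ r → γ ^ r ≡ 1ℤ [mod p ]) (trans (sym 1+s*t≡q) (ℕ.*-comm (suc s) t))
      (generator^order≡1 p-prime g g-generates)))

  power-of-e : ∀ {v} → v ∈ Subgroup.Member G → ∃[ i ] i < suc s × proj₁ v ≡ e ^ i [mod n ]
  power-of-e {v} v∈G = Generated⇒^< {n} u {suc s} e^1+s≡1 {v} v∈G

  *e^-modˡ : ∀ x i → x ℤ.* e ^ i ≡ x [mod m ]
  *e^-modˡ x i = ℤMod.trans m (ℤMod.*-congˡ m {x} (1^-mod i u≡1)) (ℤMod.*-identityʳ m x)

  *e^-modʳ : ∀ x i → x ℤ.* e ^ i ≡ x ℤ.* γ ^ (t * i) [mod p ]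
  *e^-modʳ x i = ℤMod.*-congˡ p {x} (e^-modʳ i)

  ∈coset⇒ : ∀ {x y} → y ∈ coset G x →
    y ≡ x [mod m ] × (∃[ i ] i < suc s × y ≡ x ℤ.* γ ^ (t * i) [mod p ])
  ∈coset⇒ {x} {y} (v , v∈G , y≡xv) =
    let i , i<1+s , v≡eⁱ = power-of-e v∈G
        y≡xeⁱ = ℤMod.trans n y≡xv (ℤMod.*-congˡ n {x} v≡eⁱ)
    in ℤMod.trans m (modˡ y≡xeⁱ) (*e^-modˡ x i)
     , i , i<1+s , ℤMod.trans p (modʳ y≡xeⁱ) (*e^-modʳ x i)

  -- Every power of `e` lies in `G`, whatever the exponent, so the quotient `l / t` found below can
  -- serve directly as `i`.
  ∈coset⇐ : ∀ {x y} i → y ≡ x [mod m ] → y ≡ x ℤ.* γ ^ (t * i) [mod p ] → y ∈ coset G x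
  ∈coset⇐ {x} {y} i y≡x y≡xγᵗⁱ =
    let v , v∈G , v≡eⁱ = ^∈Generated {n} u i in
    v , v∈G , subst (λ z → y ≡ x ℤ.* z [mod n ]) (sym v≡eⁱ) (recombine
      (ℤMod.trans m y≡x (ℤMod.sym m (*e^-modˡ x i)))
      (ℤMod.trans p y≡xγᵗⁱ (ℤMod.sym p (*e^-modʳ x i))))

  -- Orbits of multiplication by `γᵗ`

  -- Representatives of the orbits of multiplication by γᵗ on ℤ/p.
  orbitRep : Fin (1 + t) → ℤ
  orbitRep Fin.zero    = 0ℤ
  orbitRep (Fin.suc j) = γ ^ toℕ j

  -- The residue 0 is separated from the powers of `γ`. Between powers, the relation becomes
  -- `j′ = j + t i` with `j` and `j′` below `t`, which forces `i = 0`.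
  orbitRep-injective : ∀ {i} c c′ → i < suc s →
    orbitRep c′ ≡ orbitRep c ℤ.* γ ^ (t * i) [mod p ] → c ≡ c′
  orbitRep-injective Fin.zero Fin.zero _ _ = refl
  orbitRep-injective {i} Fin.zero (Fin.suc j) _ eq = contradiction
    (ℤMod.trans p eq (ℤMod.reflexive p (ℤ.*-zeroˡ (γ ^ (t * i)))))
    (generator^≢0 p-prime g g-generates (toℕ j))
  orbitRep-injective {i} (Fin.suc j) Fin.zero _ eq = contradiction
    (ℤMod.trans p (ℤMod.reflexive p (ℤ.^-distribˡ-+-* γ (toℕ j) (t * i))) (ℤMod.sym p eq))
    (generator^≢0 p-prime g g-generates (toℕ j + t * i))
  orbitRep-injective {i} (Fin.suc j) (Fin.suc j′) i<1+s eq =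
    cong Fin.suc (toℕ-injective (exponents i j′≡j+ti))
    where
    -- With `j < t` and `i ≤ s` the exponent stays below the order `q`, so congruent powers have
    -- equal exponents.
    j+ti<q : toℕ j + t * i < q
    j+ti<q = begin-strict
      toℕ j + t * i  <⟨ ℕ.+-monoˡ-< (t * i) (toℕ<n j) ⟩
      t + t * i      ≡⟨ ℕ.*-suc t i ⟨
      t * suc i      ≤⟨ ℕ.*-monoʳ-≤ t i<1+s ⟩
      t * suc s      ≡⟨ ℕ.*-comm t (suc s) ⟩
      suc s * t      ≡⟨ 1+s*t≡q ⟩
      q              ∎
      where open ℕ.≤-Reasoning
    t≤q : t ≤ q
    t≤q = subst (t ≤_) 1+s*t≡q (ℕ.m≤m+n t (s * t))
    j′≡j+ti : toℕ j′ ≡ toℕ j + t * i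
    j′≡j+ti = generator^-injective p-prime g g-generates (ℕ.<-≤-trans (toℕ<n j′) t≤q) j+ti<q
      (ℤMod.trans p eq (ℤMod.reflexive p (sym (ℤ.^-distribˡ-+-* γ (toℕ j) (t * i)))))
    exponents : ∀ i → toℕ j′ ≡ toℕ j + t * i → toℕ j ≡ toℕ j′
    exponents zero    eq = sym (trans eq (trans (cong (λ k → toℕ j + k) (ℕ.*-zeroʳ t)) (ℕ.+-identityʳ (toℕ j))))
    exponents (suc i) eq = contradiction (toℕ<n j′) (ℕ.≤⇒≯ (begin
      t                  ≤⟨ ℕ.m≤m*n t (suc i) ⟩
      t * suc i          ≤⟨ ℕ.m≤n+m (t * suc i) (toℕ j) ⟩
      toℕ j + t * suc i  ≡⟨ eq ⟨
      toℕ j′             ∎))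
      where open ℕ.≤-Reasoning

  -- Division of `l` by `t`: the remainder selects the orbit, the quotient counts the steps of `γᵗ`
  -- within it.
  generator^≡orbitRep : ∀ l → ∃₂ λ c i → γ ^ l ≡ orbitRep c ℤ.* γ ^ (t * i)
  generator^≡orbitRep l = Fin.suc (fromℕ< (m%n<n l t)) , l / t , (begin
    γ ^ l                                               ≡⟨ cong (γ ^_) (m≡m%n+[m/n]*n l t) ⟩
    γ ^ (l % t + l / t * t)                             ≡⟨ cong (λ k → γ ^ (l % t + k)) (ℕ.*-comm (l / t) t) ⟩
    γ ^ (l % t + t * (l / t))                           ≡⟨ ℤ.^-distribˡ-+-* γ (l % t) (t * (l / t)) ⟩
    γ ^ (l % t) ℤ.* γ ^ (t * (l / t))                   ≡⟨ cong (λ k → γ ^ k ℤ.* γ ^ (t * (l / t))) (toℕ-fromℕ< (m%n<n l t)) ⟨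
    γ ^ toℕ (fromℕ< (m%n<n l t)) ℤ.* γ ^ (t * (l / t))  ∎)
    where open ≡-Reasoning

  orbitRep-surjective : ∀ x → ∃₂ λ c i → x ≡ orbitRep c ℤ.* γ ^ (t * i) [mod p ]
  orbitRep-surjective x with x ≟ 0ℤ [mod p ]
  -- The orbit of 0 is a single point, so the exponent 0 is an arbitrary choice.
  ... | yes x≡0 = Fin.zero , 0 , x≡0
  ... | no  x≢0 =
    let l , _ , x≡γˡ = log p-prime g g-generates q (generator^order≡1 p-prime g g-generates) x x≢0
        c , i , γˡ≡cγᵗⁱ = generator^≡orbitRep l
    in c , i , subst (x ≡_[mod p ]) γˡ≡cγᵗⁱ x≡γˡ

  -- The differences `γᵗⁱ - 1` for nontrivial `i`

  -- These are the coefficients of the equation `x (γᵗⁱ - 1) ≡ d`. The shift by `suc` leaves out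
  -- `i = 0`, where the coefficient vanishes.
  factor : Fin s → ℤ
  factor j = γ ^ (t * suc (toℕ j)) ℤ.- 1ℤ

  exponent< : ∀ j → t * suc (toℕ {s} j) < q
  exponent< j = begin-strict
    t * suc (toℕ j)  <⟨ ℕ.*-monoʳ-< t (s<s (toℕ<n j)) ⟩
    t * suc s        ≡⟨ ℕ.*-comm t (suc s) ⟩
    suc s * t        ≡⟨ 1+s*t≡q ⟩
    q                ∎
    where open ℕ.≤-Reasoning

  factor-injective : ∀ {j j′} → factor j ≡ factor j′ [mod p ] → j ≡ j′
  factor-injective {j} {j′} eq = toℕ-injective (ℕ.suc-injective (ℕ.*-cancelˡ-≡ _ _ t
    (generator^-injective p-prime g g-generates (exponent< j) (exponent< j′)
      (+-cancelʳ-mod (ℤ.- 1ℤ) eq))))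

  -- A vanishing difference would make a power with positive exponent below `q` equal to `γ⁰`.
  factor≢0 : ∀ j → ¬ factor j ≡ 0ℤ [mod p ]
  factor≢0 j eq = ℕ.m<n⇒n≢0 (ℕ.<-≤-trans (>-nonZero⁻¹ t) (ℕ.m≤m*n t (suc (toℕ j))))
    (generator^-injective p-prime g g-generates (exponent< j) (>-nonZero⁻¹ q)
      (+-cancelʳ-mod (ℤ.- 1ℤ) eq))

  factor⁻¹ : Fin s → ℤ
  factor⁻¹ j = proj₁ (≢0⇒unit p-prime (factor j) (factor≢0 j))

  factor-unit : ∀ j → factor j ℤ.* factor⁻¹ j ≡ 1ℤ [mod p ]
  factor-unit j = proj₂ (≢0⇒unit p-prime (factor j) (factor≢0 j))

  -- The image of the coset index function

  module _ {k : ℕ} (h : Bijection (D G) (AbelianGroup.setoid (ℤ/ k +))) where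
    private
      f = Func.to (cosetIndex G h)

    f-≡⇐ : ∀ {x y} → y ∈ coset G x → f x ≡ f y [mod k ]
    f-≡⇐ {x} {y} y∈ = Bijection.cong h {Func.to (toCoset G) x} {Func.to (toCoset G) y}
      (coset-unique G (Func.to (toCoset G) x) y∈)

    -- Injectivity of `h` identifies the cosets of `x` and `y`, and `y` lies in its own.
    f-≡⇒ : ∀ {x y} → f x ≡ f y [mod k ] → y ∈ coset G x
    f-≡⇒ {x} {y} eq =
      proj₂ (Bijection.injective h {Func.to (toCoset G) x} {Func.to (toCoset G) y} eq) (∈-coset G y)

    -- Each coset contains exactly one representative `rep a c`: its residue modulo `m` is constant
    -- on the coset, and modulo `p` the coset is one of the `1 + t` orbits.
    image-cardinality : HasCardinality (image (cosetIndex G h)) (m * (1 + t))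
    image-cardinality = cardinality-× (image (cosetIndex G h))
      (λ a c → f (rep a c) , rep a c , ℤMod.refl k)
      (λ {a} {a′} {c} {c′} eq →
        let x′≡x , i , i<1+s , x′≡xγᵗⁱ = ∈coset⇒ (f-≡⇒ {rep a c} {rep a′ c′} eq) in
        toℕ-injective-mod (ℤMod.trans m (ℤMod.sym m (rep-modˡ a c)) (ℤMod.trans m (ℤMod.sym m x′≡x) (rep-modˡ a′ c′)))
        , orbitRep-injective c c′ i<1+s (ℤMod.trans p (ℤMod.sym p (rep-modʳ a′ c′))
            (ℤMod.trans p x′≡xγᵗⁱ (ℤMod.*-congʳ p {γ ^ (t * i)} (rep-modʳ a c)))))
      λ (y , x , fx≡y) →
        let a , a≡x = residue m x
            c , i , x≡rγᵗⁱ = orbitRep-surjective x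
        in a , c , ℤMod.trans k (f-≡⇐ (∈coset⇐ i
             (ℤMod.sym m (ℤMod.trans m (rep-modˡ a c) a≡x))
             (ℤMod.trans p x≡rγᵗⁱ (ℤMod.*-congʳ p {γ ^ (t * i)} (ℤMod.sym p (rep-modʳ a c)))))) fx≡y
      where
      rep : Fin m → Fin (1 + t) → ℤ
      rep a c = proj₁ (crt m⊥p (+ toℕ a) (orbitRep c))
      rep-modˡ : ∀ a c → rep a c ≡ + toℕ a [mod m ]
      rep-modˡ a c = proj₁ (proj₂ (crt m⊥p (+ toℕ a) (orbitRep c)))
      rep-modʳ : ∀ a c → rep a c ≡ orbitRep c [mod p ]
      rep-modʳ a c = proj₂ (proj₂ (crt m⊥p (+ toℕ a) (orbitRep c)))

    -- Counting the solutions of `f (x + d) = f x`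

    fiber : ℤ → Setoid 0ℓ 0ℓ
    fiber d = subsetoid (ℤMod.setoid n) λ x → f (x ℤ.+ d) ≡ f x [mod k ]

    -- Elements of one coset agree modulo `m`, so a solution `x` would give `x + d ≡ x` there.
    fiber-empty : ∀ {d} → ¬ d ≡ 0ℤ [mod m ] → HasCardinality (fiber d) 0
    fiber-empty {d} d≢0 = cardinality (fiber d) (λ ()) (λ { {()} }) λ (x , eq) →
      contradiction (translate-fixed x (proj₁ (∈coset⇒ (f-≡⇒ (ℤMod.sym k eq))))) d≢0

    module _ {d : ℤ} (d≡0 : d ≡ 0ℤ [mod m ]) (d≢0 : ¬ d ≡ 0ℤ [mod p ]) where
      -- The solution with free residue `a` modulo `m` and, modulo `p`, the root of
      -- `x * factor j ≡ d`.
      sol : Fin m → Fin s → ℤ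
      sol a j = proj₁ (crt m⊥p (+ toℕ a) (d ℤ.* factor⁻¹ j))

      sol-modˡ : ∀ a j → sol a j ≡ + toℕ a [mod m ]
      sol-modˡ a j = proj₁ (proj₂ (crt m⊥p (+ toℕ a) (d ℤ.* factor⁻¹ j)))

      sol-root : ∀ a j → sol a j ℤ.* factor j ≡ d [mod p ]
      sol-root a j = begin
        sol a j ℤ.* factor j                 ≈⟨ ℤMod.*-congʳ p {factor j} (proj₂ (proj₂ (crt m⊥p (+ toℕ a) (d ℤ.* factor⁻¹ j)))) ⟩
        d ℤ.* factor⁻¹ j ℤ.* factor j        ≡⟨ regroup d (factor⁻¹ j) (factor j) ⟩
        d ℤ.* (factor j ℤ.* factor⁻¹ j)      ≈⟨ ℤMod.*-congˡ p {d} (factor-unit j) ⟩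
        d ℤ.* 1ℤ                             ≡⟨ ℤ.*-identityʳ d ⟩
        d                                    ∎
        where
        open SetoidReasoning (ℤMod.setoid p)
        regroup : ∀ a b c → a ℤ.* b ℤ.* c ≡ a ℤ.* (c ℤ.* b)
        regroup = solve-∀

      -- A root that vanished modulo `p` would force `d ≡ 0`. Invertibility is what later recovers
      -- `j` from the solution.
      sol-unit : ∀ a j → ∃[ w ] sol a j ℤ.* w ≡ 1ℤ [mod p ]
      sol-unit a j = ≢0⇒unit p-prime (sol a j) λ sol≡0 →
        d≢0 (ℤMod.trans p (ℤMod.sym p (sol-root a j)) (ℤMod.*-congʳ p {factor j} sol≡0))

      root-unique : ∀ a j x → x ℤ.+ d ≡ x ℤ.* γ ^ (t * suc (toℕ j)) [mod p ] → sol a j ≡ x [mod p ]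
      root-unique a j x eq = *-cancelˡ-mod (factor j) (factor⁻¹ j) (factor-unit j) (begin
        factor j ℤ.* sol a j  ≡⟨ ℤ.*-comm (factor j) (sol a j) ⟩
        sol a j ℤ.* factor j  ≈⟨ sol-root a j ⟩
        d                     ≈⟨ translate-scale {p} {d} x (γ ^ (t * suc (toℕ j))) eq ⟨
        x ℤ.* factor j        ≡⟨ ℤ.*-comm x (factor j) ⟩
        factor j ℤ.* x        ∎)
        where open SetoidReasoning (ℤMod.setoid p)

      γ^t*0-trivial : ∀ x → ¬ x ℤ.+ d ≡ x ℤ.* γ ^ (t * 0) [mod p ]
      γ^t*0-trivial x eq = d≢0 (translate-fixed x (subst (x ℤ.+ d ≡_[mod p ])
        (trans (cong (λ i → x ℤ.* γ ^ i) (ℕ.*-zeroʳ t)) (ℤ.*-identityʳ x)) eq))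

      position : ∀ {x} → ∃[ i ] (i < suc s × x ℤ.+ d ≡ x ℤ.* γ ^ (t * i) [mod p ]) →
        ∀ a → ∃[ j ] sol a j ≡ x [mod p ]
      -- Exponent 0 would mean `x + d ≡ x` modulo `p`; the remaining exponents are `suc i` with
      -- `i < s`, matching the shift in `factor`.
      position {x} (zero  , _       , eq) a = contradiction eq (γ^t*0-trivial x)
      position {x} (suc i , s<s i<s , eq) a = fromℕ< i<s , root-unique a (fromℕ< i<s) x
        (subst (λ i → x ℤ.+ d ≡ x ℤ.* γ ^ (t * suc i) [mod p ]) (sym (toℕ-fromℕ< i<s)) eq)

      complete : ∀ (x : Setoid.Carrier (fiber d)) → ∃₂ λ a j → sol a j ≡ proj₁ x [mod n ]
      complete (x , eq) =
        let a , a≡x = residue m x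
            j , sol≡x = position (proj₂ (∈coset⇒ {x} (f-≡⇒ (ℤMod.sym k eq)))) a
        in a , j , recombine (ℤMod.trans m (sol-modˡ a j) a≡x) sol≡x

      fiber-cardinality : HasCardinality (fiber d) (m * s)
      fiber-cardinality = cardinality-× (fiber d)
        (λ a j → sol a j , ℤMod.sym k (f-≡⇐ (∈coset⇐ (suc (toℕ j))
          (translate-by-0 (sol a j) d≡0)
          (scale-translate (sol a j) (γ ^ (t * suc (toℕ j))) (sol-root a j)))))
        (λ {a} {a′} {j} {j′} eq →
          toℕ-injective-mod (ℤMod.trans m (ℤMod.sym m (sol-modˡ a j)) (ℤMod.trans m (modˡ eq) (sol-modˡ a′ j′)))
          -- Equal solutions satisfy `x * factor j ≡ d ≡ x * factor j′`; cancelling the unit `x`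
          -- leaves equal factors.
          , factor-injective (*-cancelˡ-mod (sol a j) (proj₁ (sol-unit a j)) (proj₂ (sol-unit a j))
              (ℤMod.trans p (sol-root a j) (ℤMod.sym p
                (ℤMod.trans p (ℤMod.*-congʳ p {factor j′} (modʳ eq)) (sol-root a′ j′))))))
        complete

    fiber-zero-difference : ∀ d → ¬ d ≡ 0ℤ [mod n ] →
      ∃[ l ] HasCardinality (fiber d) l × l ∈ ｛ 0 ｝ ∪ ｛ m * s ｝
    fiber-zero-difference d d≢0 with d ≟ 0ℤ [mod m ]
    -- If `d` also vanished modulo `p`, it would vanish modulo `n` by the Chinese remainder theorem.
    ... | yes d≡0 = m * s , fiber-cardinality d≡0 (d≢0 ∘ recombine d≡0) , inj₂ refl
    ... | no  d≢0 = 0 , fiber-empty d≢0 , inj₁ refl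

    zero-difference : ∀ .{{_ : NonZero k}} →
      IsZeroDifference (ℤ/ n +) (ℤ/ k +) (cosetIndex G h) n (m * (1 + t)) (｛ 0 ｝ ∪ ｛ m * s ｝)
    zero-difference = record
      { ∣A∣≡n       = ℤ/-cardinality n {{n-nonZero}}
      ; B-finite    = k , ℤ/-cardinality k
      ; ∣f[A]∣≡m    = image-cardinality
      ; differences = fiber-zero-difference
      }
      where
      n-nonZero : NonZero n
      n-nonZero = subst NonZero (sym n≡m*p) (ℕ.m*n≢0 m p)

theorem3p9 : ∀ (m p : ℕ) → 0 < m → Prime p → gcd m p ≡ 1 →
    ∀ (s t : ℕ) → 0 < s → 0 < t → s * t ≡ p ∸ 1 →
    ∀ (g : Group.Carrier (ℤ/ p ˣ)) → IsGenerator (ℤ/ p ˣ) g →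
    ∀ (e : ℤ) (e≡1 : e ≡ 1ℤ [mod m ]) (e≡gᵗ : e ≡ proj₁ g ^ t [mod p ]) →
    let n = m * p
        G = ⟨_⟩ (ℤ/ n ˣ) (congruenceUnit m p t e g e≡1 e≡gᵗ)
    in
    ∀ (k : ℕ) → HasCardinality (D G) k →
    ∀ (h : Bijection (D G) (AbelianGroup.setoid (ℤ/ k +))) →
    IsZeroDifference (ℤ/ n +) (ℤ/ k +) (cosetIndex G h)
      n (m * (1 + t)) (｛ 0 ｝ ∪ ｛ m * (s ∸ 1) ｝)
theorem3p9 m zero    _   p-prime = contradiction p-prime ¬prime[0]
theorem3p9 m (suc q) 0<m p-prime gcd≡1 (suc s) t _ 0<t st≡q g g-generates e e≡1 e≡gᵗ k |D|≡k h =
  zero-difference {{>-nonZero 0<m}} p-prime (gcd≡1⇒coprime gcd≡1) refl {{>-nonZero 0<t}} st≡q g g-generates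
    -- The index of the coset of 0 inhabits `Fin k`, so `k` is positive and `ℤ/ k` is finite.
    u e≡1 e≡gᵗ h {{Fin.nonZeroIndex (Bijection.to |D|≡k (Func.to (toCoset G) 0ℤ))}}
  where
  u = congruenceUnit m (suc q) t e g e≡1 e≡gᵗ
  G = ⟨_⟩ (ℤ/ m * suc q ˣ) u
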